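{- For every zero-set $\mathcal Z\subseteq\mathbb Z_+^2$, $$\tfrac14\,|\mathcal Z|\le \gamma(\mathcal Z)\le |\mathcal Z|.$$
   Context: $\mathbb Z_+=\{0,1,2,\dots\}$. For positive integers $a,b$ let $R_{a,b}=([0,a-1]\times[0,b-1])\cap\mathbb Z_+^2$. A (discrete) zero-set is a set $\mathcal Z\subseteq\mathbb Z_+^2$ that is a union of sets of the form $R_{a,b}$ (the empty set allowed; $\mathcal Z$ may be infinite). For $A\subseteq\mathbb Z_+^2$ and $x\in\mathbb Z_+^2$, let $\mathrm{row}(x,A)$ (resp. $\mathrm{col}(x,A)$) be the number of points of $A$ on the horizontal (resp. vertical) line through $x$. The neighborhood growth transformation with zero-set $\mathcal Z$ is $\mathcal T(A)=A\cup\{x\in\mathbb Z_+^2\setminus A:(\mathrm{row}(x,A),\mathrm{col}(x,A))\notin\mathcal Z\}$. A set $A$ spans (for $\mathcal Z$) if $\bigcup_{t\ge0}\mathcal T^t(A)=\mathbb Z_+^2$. $\gamma(\mathcal Z)$ is the minimum cardinality of a finite set that spans for $\mathcal Z$ (with the convention $\gamma(\mathcal Z)=\infty$ if no finite set spans). -}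

module Defs where

open import Data.Nat using (ℕ; _<_; _≤_; _*_)
open import Data.Product using (_×_; _,_; Σ; ∃; ∃-syntax)
open import Data.Sum using (_⊎_)
open import Data.List using (List; length)
open import Data.List.Membership.Propositional using (_∈_)
open import Data.List.Relation.Unary.All using (All)
open import Data.List.Relation.Unary.Unique.Propositional using (Unique)
open import Relation.Nullary using (¬_)
open import Relation.Binary.PropositionalEquality using (_≡_)
open import Function.Bundles using (_⇔_)

Point : Set
Point = ℕ × ℕ

Subset : Set₁
Subset = Point → Set

InRect : ℕ → ℕ → Point → Set
InRect a b (i , j) = i < a × j < b

-- Z is a zero-set: Z is a union of sets R_{a,b}, i.e. every point of Z lies in
-- some R_{a,b} that is contained in Z (the empty union is allowed).
IsZeroSet : Subset → Set
IsZeroSet Z = ∀ x → Z x → ∃[ a ] ∃[ b ] (InRect a b x × (∀ y → InRect a b y → Z y))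

HasCard : Subset → ℕ → Set
HasCard S n = ∃[ xs ] (Unique xs × length xs ≡ n × (∀ x → S x ⇔ (x ∈ xs)))

AtLeast : Subset → ℕ → Set
AtLeast S n = ∃[ xs ] (Unique xs × length xs ≡ n × All S xs)

RowSet : Subset → Point → Subset
RowSet A (_ , y) (p , q) = A (p , q) × q ≡ y

ColSet : Subset → Point → Subset
ColSet A (x , _) (p , q) = A (p , q) × p ≡ x

Infinite : Subset → Set
Infinite S = ∀ n → AtLeast S n

-- (row(x,A), col(x,A)) ∉ Z, where row/col are cardinalities in ℕ ∪ {∞};
-- a pair with an infinite coordinate is never in Z ⊆ ℤ₊².
CountsOutside : Subset → Subset → Point → Set
CountsOutside Z A x =
  (∃[ r ] ∃[ c ] (HasCard (RowSet A x) r × HasCard (ColSet A x) c × ¬ Z (r , c)))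
  ⊎ Infinite (RowSet A x) ⊎ Infinite (ColSet A x)

-- Neighborhood growth transformation
-- T(A) = A ∪ {x ∉ A : (row(x,A),col(x,A)) ∉ Z}  (= A ∪ {x : ...} as a set).
T : Subset → Subset → Subset
T Z A x = A x ⊎ CountsOutside Z A x

Iter : Subset → ℕ → Subset → Subset
Iter Z ℕ.zero A = A
Iter Z (ℕ.suc t) A = T Z (Iter Z t A)

ListSet : List Point → Subset
ListSet xs x = x ∈ xs

Spans : Subset → Subset → Set
Spans Z A = ∀ x → ∃[ t ] Iter Z t A x

FinSpans : Subset → List Point → Set
FinSpans Z xs = Unique xs × Spans Z (ListSet xs)

{-# OPTIONS --safe #-}

-- Lower bound.  Let r₀ ≥ r₁ ≥ … and c₀ ≥ c₁ ≥ … be the row and column counts of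
-- a spanning set A.  If (i + r_j , j + c_i) were in Z, then adding to A its i
-- fullest columns and j fullest rows would give a proper subset of the plane
-- closed under T.  Hence Z misses every (i + r_j , j + c_i), and this alone
-- forces |Z| ≤ 2 (Σ r + Σ c) = 4 |A|: the condition persists when the two bottom
-- rows of Z are removed, r₀ is dropped and each positive c_i is lowered by one,
-- while each of the two rows has length at most r₀ + #{i : c_i > 0}.
--
-- Upper bound.  Z itself spans, since its rows fill up one after the other.
module Submission where

open import Defs
open import Data.Nat using (ℕ; zero; suc; pred; _+_; _*_; _≤_; _<_; _<?_; z≤n; s≤s)
open import Data.Nat.Properties
open import Data.Nat.Induction using (<-wellFounded)
open import Data.Nat.ListAction using (sum)
open import Data.Nat.Tactic.RingSolver using (solve-∀)
open import Data.Product using (_×_; _,_; ∃-syntax; proj₁; proj₂)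
open import Data.Product.Properties using (≡-dec)
open import Data.Sum using (_⊎_; inj₁; inj₂)
open import Data.List using (List; []; _∷_; length; _++_; map; filter; upTo; applyUpTo)
open import Data.List.Properties using (length-++; length-map; length-upTo; length-applyUpTo; filter-some; filter-none; filter-reject)
open import Data.List.Extrema.Nat using (argmax; f[xs]≤f[argmax]; max; xs≤max)
open import Data.List.Membership.Propositional using (_∈_; _∉_)
open import Data.List.Membership.Propositional.Properties
open import Data.List.Relation.Unary.All as All using (All; []; _∷_)
import Data.List.Relation.Unary.All.Properties as All
open import Data.List.Relation.Unary.AllPairs using ([]; _∷_)
open import Data.List.Relation.Unary.Any using (here; there)
open import Data.List.Relation.Unary.Unique.Propositional using (Unique)
import Data.List.Relation.Unary.Unique.Propositional.Properties as Unique
open import Function using (_∘_)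
open import Function.Bundles using (mk⇔; module Equivalence)
open import Induction.WellFounded using (Acc; acc)
open import Relation.Binary.PropositionalEquality
open import Relation.Nullary using (¬_; Dec; yes; no; contradiction; ¬?)
open import Relation.Unary using (Decidable)

open import Data.List.Membership.DecPropositional (≡-dec _≟_ _≟_) using () renaming (_∈?_ to _∈ᵖ?_)
open import Data.List.Membership.DecPropositional _≟_ using (_∈?_)

open Equivalence using (to; from)

-- Cardinalities

-- Induction on `xs`: striking one occurrence of the head out of `ys` leaves a list that still
-- contains the tail, since the head does not recur there.
unique-⊆⇒length≤ : ∀ {X : Set} {xs ys : List X} → Unique xs →
  (∀ {x} → x ∈ xs → x ∈ ys) → length xs ≤ length ys
unique-⊆⇒length≤ [] _ = z≤n
unique-⊆⇒length≤ {xs = x ∷ xs} (x∉xs ∷ uxs) xs⊆ys with ∈-∃++ (xs⊆ys (here refl))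
... | as , bs , refl = begin
  suc (length xs)              ≤⟨ s≤s (unique-⊆⇒length≤ uxs xs⊆as++bs) ⟩
  suc (length (as ++ bs))      ≡⟨ cong suc (length-++ as) ⟩
  suc (length as + length bs)  ≡⟨ +-suc (length as) (length bs) ⟨
  length as + suc (length bs)  ≡⟨ length-++ as ⟨
  length (as ++ x ∷ bs)        ∎
  where
  open ≤-Reasoning
  xs⊆as++bs : ∀ {y} → y ∈ xs → y ∈ as ++ bs
  xs⊆as++bs y∈xs with ∈-++⁻ as (xs⊆ys (there y∈xs))
  ... | inj₁ y∈as = ∈-++⁺ˡ y∈as
  ... | inj₂ (here refl) = contradiction refl (All.lookup x∉xs y∈xs)
  ... | inj₂ (there y∈bs) = ∈-++⁺ʳ as y∈bs

atLeast-cover : ∀ {S n} (ys : List Point) → (∀ {x} → S x → x ∈ ys) → AtLeast S n → n ≤ length ys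
atLeast-cover ys S⊆ys (xs , uxs , refl , Sxs) = unique-⊆⇒length≤ uxs (S⊆ys ∘ All.lookup Sxs)

hasCard⇒atLeast : ∀ {S n} → HasCard S n → AtLeast S n
hasCard⇒atLeast (xs , uxs , ≡n , S⇔xs) = xs , uxs , ≡n , All.tabulate (from (S⇔xs _))

atLeast≤hasCard : ∀ {S m n} → AtLeast S m → HasCard S n → m ≤ n
atLeast≤hasCard S≥m (xs , _ , refl , S⇔xs) = atLeast-cover xs (to (S⇔xs _)) S≥m

hasCard-unique : ∀ {S m n} → HasCard S m → HasCard S n → m ≡ n
hasCard-unique p q =
  ≤-antisym (atLeast≤hasCard (hasCard⇒atLeast p) q) (atLeast≤hasCard (hasCard⇒atLeast q) p)

infinite⇒¬hasCard : ∀ {S n} → Infinite S → ¬ HasCard S n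
infinite⇒¬hasCard {n = n} ∞ p = 1+n≰n (atLeast≤hasCard (∞ (suc n)) p)

DownClosed : Subset → Set
DownClosed Z = ∀ {a b c d} → a ≤ c → b ≤ d → Z (c , d) → Z (a , b)

zeroSet⇒downClosed : ∀ {Z} → IsZeroSet Z → DownClosed Z
zeroSet⇒downClosed zs a≤c b≤d Zcd with zs _ Zcd
... | _ , _ , (c<e , d<f) , R⊆Z = R⊆Z _ (≤-<-trans a≤c c<e , ≤-<-trans b≤d d<f)

-- Lower bound

fibre : {X : Set} → (X → ℕ) → ℕ → List X → List X
fibre f k = filter (λ x → f x ≟ k)

outsideFibre : {X : Set} → (X → ℕ) → ℕ → List X → List X
outsideFibre f k = filter (λ x → ¬? (f x ≟ k))

module _ {X : Set} {P : X → Set} (P? : Decidable P) where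

  length-filter-split : ∀ xs → length (filter P? xs) + length (filter (¬? ∘ P?) xs) ≡ length xs
  length-filter-split [] = refl
  length-filter-split (x ∷ xs) with P? x
  ... | yes _ = cong suc (length-filter-split xs)
  ... | no _ = trans (+-suc _ _) (cong suc (length-filter-split xs))

  filter-disjoint : ∀ {Q : X → Set} (Q? : Decidable Q) → (∀ {x} → Q x → ¬ P x) → ∀ xs →
    filter Q? (filter (¬? ∘ P?) xs) ≡ filter Q? xs
  filter-disjoint Q? Q⇒¬P [] = refl
  filter-disjoint Q? Q⇒¬P (x ∷ xs) with P? x
  ... | yes px = trans (filter-disjoint Q? Q⇒¬P xs) (sym (filter-reject Q? (λ qx → Q⇒¬P qx px)))
  ... | no _ with Q? x
  ...   | yes _ = cong (x ∷_) (filter-disjoint Q? Q⇒¬P xs)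
  ...   | no _ = filter-disjoint Q? Q⇒¬P xs

-- Off `ks` the values vanish, so a maximum over `ks` and the default index 0 is a maximum over all
-- indices.
maximiser : ∀ (g : ℕ → ℕ) ks → (∀ l → l ∉ ks → g l ≡ 0) → ∃[ k ] (∀ l → g l ≤ g k)
maximiser g ks support = k , ≤k
  where
  k : ℕ
  k = argmax g 0 ks
  ≤k : ∀ l → g l ≤ g k
  ≤k l with l ∈? ks
  ... | yes l∈ks = All.lookup (f[xs]≤f[argmax] {f = g} 0 ks) l∈ks
  ... | no l∉ks = subst (_≤ g k) (sym (support l l∉ks)) z≤n

module _ {X : Set} (f : X → ℕ) where

  length-fibre-split : ∀ k xs → length (fibre f k xs) + length (outsideFibre f k xs) ≡ length xs
  length-fibre-split k = length-filter-split (λ x → f x ≟ k)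

  fibre-outsideFibre : ∀ {k l} → l ≢ k → ∀ xs → fibre f l (outsideFibre f k xs) ≡ fibre f l xs
  fibre-outsideFibre {k} {l} l≢k = filter-disjoint (λ x → f x ≟ k) (λ x → f x ≟ l)
    (λ fx≡l fx≡k → l≢k (trans (sym fx≡l) fx≡k))

  length-fibre≡0 : ∀ xs l → l ∉ map f xs → length (fibre f l xs) ≡ 0
  length-fibre≡0 xs l l∉ = cong length (filter-none (λ x → f x ≟ l) {xs}
    (All.tabulate (λ x∈xs fx≡l → l∉ (subst (_∈ map f xs) fx≡l (∈-map⁺ f x∈xs)))))

  largestFibre : ∀ xs → ∃[ k ] (∀ l → length (fibre f l xs) ≤ length (fibre f k xs))
  largestFibre xs = maximiser (λ l → length (fibre f l xs)) (map f xs) (length-fibre≡0 xs)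

-- Value 0 past the end of the list.
nth : List ℕ → ℕ → ℕ
nth [] _ = 0
nth (x ∷ xs) zero = x
nth (x ∷ xs) (suc i) = nth xs i

-- Satisfied when r lists the fibre sizes in decreasing order.
FibreProfile : {X : Set} → (X → ℕ) → List X → List ℕ → Set
FibreProfile f xs r = ∀ j → ∃[ K ] (length K ≤ j × (∀ l → l ∉ K → length (fibre f l xs) ≤ nth r j))

-- A largest fibre is split off repeatedly: its size becomes the next entry of `r`, and the first
-- `j` removed keys form the exceptional list `K`.
fibreProfile : ∀ {X : Set} (f : X → ℕ) xs → ∃[ r ] (sum r ≡ length xs × FibreProfile f xs r)
fibreProfile f xs = go xs (<-wellFounded _)
  where
  go : ∀ xs → Acc _<_ (length xs) → ∃[ r ] (sum r ≡ length xs × FibreProfile f xs r)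
  go [] _ = [] , refl , λ j → [] , z≤n , λ _ _ → z≤n
  go xs@(x ∷ _) (acc rec) with largestFibre f xs
  ... | k , ≤k with go (outsideFibre f k xs) (rec rest<xs)
    where
    -- The largest fibre is nonempty, being at least as large as the fibre of the head `x`.
    rest<xs : length (outsideFibre f k xs) < length xs
    rest<xs = subst (length (outsideFibre f k xs) <_) (length-fibre-split f k xs)
      (m<n+m _ (<-≤-trans (filter-some (λ y → f y ≟ f x) {xs} (here refl)) (≤k (f x))))
  ...   | r , sum-r , prof =
    length (fibre f k xs) ∷ r ,
    trans (cong (length (fibre f k xs) +_) sum-r) (length-fibre-split f k xs) ,
    λ where
      zero → [] , z≤n , λ l _ → ≤k l
      (suc j) → let K , |K|≤j , small = prof j in
        -- Removing the fibre over `k` leaves the fibres over all other keys unchanged.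
        k ∷ K , s≤s |K|≤j , λ l l∉ →
          subst (λ ys → length ys ≤ nth r j) (fibre-outsideFibre f (l∉ ∘ here) xs)
            (small l (l∉ ∘ there))

-- A proper subset of the plane closed under `T`

fresh : ∀ (xs : List ℕ) → ∃[ n ] n ∉ xs
fresh xs = suc (max 0 xs) , λ n∈xs → 1+n≰n (All.lookup (xs≤max 0 xs) n∈xs)

module _ {Z : Subset} (down : DownClosed Z) (A : List Point) where

  -- If (i + r_j , j + c_i) ∈ Z, then A together with the i most populated
  -- columns and the j most populated rows is closed under T.
  module _ (I J : List ℕ) {r c : ℕ}
           (row≤ : ∀ y → y ∉ J → length (fibre proj₂ y A) ≤ r)
           (col≤ : ∀ x → x ∉ I → length (fibre proj₁ x A) ≤ c)
           (Zrc : Z (length I + r , length J + c)) where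

    Closed : Subset
    Closed p = p ∈ A ⊎ proj₁ p ∈ I ⊎ proj₂ p ∈ J

    closed? : Decidable Closed
    closed? p with p ∈ᵖ? A | proj₁ p ∈? I | proj₂ p ∈? J
    ... | yes a | _ | _ = yes (inj₁ a)
    ... | no _ | yes b | _ = yes (inj₂ (inj₁ b))
    ... | no _ | no _ | yes c = yes (inj₂ (inj₂ c))
    ... | no ¬a | no ¬b | no ¬c = no λ where
      (inj₁ a) → ¬a a
      (inj₂ (inj₁ b)) → ¬b b
      (inj₂ (inj₂ c)) → ¬c c

    module _ {S : Subset} (S⊆ : ∀ p → S p → Closed p) where

      -- A row outside `J` meets `Closed` only in its at most `r` points of `A` and in one point for
      -- each column of `I`.
      row-bound : ∀ {x y n} → y ∉ J → AtLeast (RowSet S (x , y)) n → n ≤ length I + r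
      row-bound {x} {y} {n} y∉J row≥n = begin
        n                                           ≤⟨ atLeast-cover (map (_, y) I ++ fibre proj₂ y A) cover row≥n ⟩
        length (map (_, y) I ++ fibre proj₂ y A)    ≡⟨ length-++ (map (_, y) I) ⟩
        length (map (_, y) I) + length (fibre proj₂ y A) ≡⟨ cong (_+ _) (length-map (_, y) I) ⟩
        length I + length (fibre proj₂ y A)         ≤⟨ +-monoʳ-≤ (length I) (row≤ y y∉J) ⟩
        length I + r                                ∎
        where
        open ≤-Reasoning
        cover : ∀ {p} → RowSet S (x , y) p → p ∈ map (_, y) I ++ fibre proj₂ y A
        cover {p} (Sp , refl) with S⊆ p Sp
        ... | inj₁ p∈A = ∈-++⁺ʳ (map (_, y) I) (∈-filter⁺ (λ q → proj₂ q ≟ y) p∈A refl)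
        ... | inj₂ (inj₁ ∈I) = ∈-++⁺ˡ (∈-map⁺ (_, y) ∈I)
        ... | inj₂ (inj₂ ∈J) = contradiction ∈J y∉J

      col-bound : ∀ {x y n} → x ∉ I → AtLeast (ColSet S (x , y)) n → n ≤ length J + c
      col-bound {x} {y} {n} x∉I col≥n = begin
        n                                           ≤⟨ atLeast-cover (map (x ,_) J ++ fibre proj₁ x A) cover col≥n ⟩
        length (map (x ,_) J ++ fibre proj₁ x A)    ≡⟨ length-++ (map (x ,_) J) ⟩
        length (map (x ,_) J) + length (fibre proj₁ x A) ≡⟨ cong (_+ _) (length-map (x ,_) J) ⟩
        length J + length (fibre proj₁ x A)         ≤⟨ +-monoʳ-≤ (length J) (col≤ x x∉I) ⟩
        length J + c                                ∎
        where
        open ≤-Reasoning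
        cover : ∀ {p} → ColSet S (x , y) p → p ∈ map (x ,_) J ++ fibre proj₁ x A
        cover {p} (Sp , refl) with S⊆ p Sp
        ... | inj₁ p∈A = ∈-++⁺ʳ (map (x ,_) J) (∈-filter⁺ (λ q → proj₁ q ≟ x) p∈A refl)
        ... | inj₂ (inj₁ ∈I) = contradiction ∈I x∉I
        ... | inj₂ (inj₂ ∈J) = ∈-++⁺ˡ (∈-map⁺ (x ,_) ∈J)

      -- At a point outside `Closed` both counts obey the bounds above, so they are finite and, by
      -- down-closure, form a pair in `Z`. `S` is any subset of `Closed`, so that each iterate can
      -- be put for it in turn.
      T-closed : ∀ p → T Z S p → Closed p
      T-closed p (inj₁ Sp) = S⊆ p Sp
      T-closed p@(x , y) (inj₂ out) with closed? p
      ... | yes Cp = Cp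
      ... | no ¬Cp = contradiction out λ where
          (inj₁ (_ , _ , row , col , ∉Z)) →
            ∉Z (down (row-bound {x} y∉J (hasCard⇒atLeast row)) (col-bound {x} {y} x∉I (hasCard⇒atLeast col)) Zrc)
          (inj₂ (inj₁ row∞)) → 1+n≰n (row-bound {x} y∉J (row∞ _))
          (inj₂ (inj₂ col∞)) → 1+n≰n (col-bound {x} {y} x∉I (col∞ _))
        where
        x∉I : x ∉ I
        x∉I = ¬Cp ∘ inj₂ ∘ inj₁
        y∉J : y ∉ J
        y∉J = ¬Cp ∘ inj₂ ∘ inj₂

    iter-closed : ∀ t p → Iter Z t (ListSet A) p → Closed p
    iter-closed zero p = inj₁
    iter-closed (suc t) p = T-closed (iter-closed t) p

    -- A point whose column avoids `I` and all of `A`, and whose row avoids `J`, is never reached.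
    closed⇒¬spans : ¬ Spans Z (ListSet A)
    closed⇒¬spans spans with fresh (I ++ map proj₁ A) | fresh J
    ... | x , x∉ | y , y∉J with spans (x , y)
    ...   | t , xy with iter-closed t (x , y) xy
    ...     | inj₁ ∈A = x∉ (∈-++⁺ʳ I (∈-map⁺ proj₁ ∈A))
    ...     | inj₂ (inj₁ ∈I) = x∉ (∈-++⁺ˡ ∈I)
    ...     | inj₂ (inj₂ ∈J) = y∉J ∈J

-- From the avoided points to a bound on the size of `Z`

Avoids : Subset → List ℕ → List ℕ → Set
Avoids Z r c = ∀ i j → ¬ Z (i + nth r j , j + nth c i)

spans⇒avoids : ∀ {Z} → DownClosed Z → ∀ {A} r c → FibreProfile proj₂ A r → FibreProfile proj₁ A c →
  Spans Z (ListSet A) → Avoids Z r c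
spans⇒avoids down {A} r c prof-r prof-c spans i j Zij with prof-c i | prof-r j
... | I , |I|≤i , col≤ | J , |J|≤j , row≤ =
  -- The exceptional lists may be shorter than `i` and `j`; down-closure replaces `i` and `j` by
  -- their actual lengths.
  closed⇒¬spans down A I J row≤ col≤ (down (+-monoˡ-≤ _ |I|≤i) (+-monoˡ-≤ _ |J|≤j) Zij) spans

positives : List ℕ → ℕ
positives [] = 0
positives (zero ∷ c) = positives c
positives (suc _ ∷ c) = suc (positives c)

sum-pred : ∀ c → sum c ≡ positives c + sum (map pred c)
sum-pred [] = refl
sum-pred (zero ∷ c) = sum-pred c
sum-pred (suc x ∷ c) = cong suc (begin
  x + sum c                                ≡⟨ cong (x +_) (sum-pred c) ⟩
  x + (positives c + sum (map pred c))     ≡⟨ swap x (positives c) (sum (map pred c)) ⟩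
  positives c + (x + sum (map pred c))     ∎)
  where
  open ≡-Reasoning
  swap : ∀ a b d → a + (b + d) ≡ b + (a + d)
  swap = solve-∀

nth-map-pred : ∀ c i → nth (map pred c) i ≡ pred (nth c i)
nth-map-pred [] i = refl
nth-map-pred (x ∷ c) zero = refl
nth-map-pred (x ∷ c) (suc i) = nth-map-pred c i

-- Only positive entries precede the first zero, and past the end `nth` is 0.
∃-nth≡0 : ∀ c → ∃[ i ] (i ≤ positives c × nth c i ≡ 0)
∃-nth≡0 [] = 0 , z≤n , refl
∃-nth≡0 (zero ∷ c) = 0 , z≤n , refl
∃-nth≡0 (suc _ ∷ c) = let i , i≤ , eq = ∃-nth≡0 c in suc i , s≤s i≤ , eq

tail : List ℕ → List ℕ
tail [] = []
tail (_ ∷ r) = r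

nth-tail : ∀ r j → nth (tail r) j ≡ nth r (suc j)
nth-tail [] j = refl
nth-tail (_ ∷ r) j = refl

sum-tail : ∀ r → sum r ≡ nth r 0 + sum (tail r)
sum-tail [] = refl
sum-tail (_ ∷ r) = refl

shift₂ : Subset → Subset
shift₂ Z (u , v) = Z (u , 2 + v)

-- This is the old condition at `(i , suc j)`: the index shift and the lowered entry of `c` each
-- change the second coordinate by at most one, and the two deleted rows make up for both.
avoids-shift₂ : ∀ {Z} r c → DownClosed Z → Avoids Z r c → Avoids (shift₂ Z) (tail r) (map pred c)
avoids-shift₂ r c down av i j Zij = av i (suc j)
  (down (≤-reflexive (cong (i +_) (sym (nth-tail r j)))) le Zij)
  where
  n≤1+pred[n] : ∀ n → n ≤ suc (pred n)
  n≤1+pred[n] zero = z≤n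
  n≤1+pred[n] (suc n) = ≤-refl
  le : suc j + nth c i ≤ 2 + (j + nth (map pred c) i)
  le = s≤s (begin
    j + nth c i                       ≤⟨ +-monoʳ-≤ j (n≤1+pred[n] (nth c i)) ⟩
    j + suc (pred (nth c i))          ≡⟨ +-suc j _ ⟩
    suc (j + pred (nth c i))          ≡⟨ cong (λ z → suc (j + z)) (nth-map-pred c i) ⟨
    suc (j + nth (map pred c) i)      ∎)
    where open ≤-Reasoning

-- Taking `j = 0` and an index `i ≤ positives c` where `c` vanishes shows that `(i + nth r 0 , 0)`
-- is not in `Z`; down-closure then excludes everything from that column on.
width-bound : ∀ {Z u v} r c → DownClosed Z → Avoids Z r c → Z (u , v) → u < nth r 0 + positives c
width-bound {u = u} {v} r c down av Zuv with u <? nth r 0 + positives c | ∃-nth≡0 c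
... | yes u< | _ = u<
... | no u≮ | i , i≤ , eq = contradiction (down le (subst (_≤ v) (sym eq) z≤n) Zuv) (av i 0)
  where
  open ≤-Reasoning
  le : i + nth r 0 ≤ u
  le = begin
    i + nth r 0            ≤⟨ +-monoˡ-≤ _ i≤ ⟩
    positives c + nth r 0  ≡⟨ +-comm (positives c) _ ⟩
    nth r 0 + positives c  ≤⟨ ≮⇒≥ u≮ ⟩
    u                      ∎

-- Induction on `k`, which bounds both the length of `r` and the entries of `c`; removing two rows
-- of `Z` lowers both bounds by one. `L` may contain points outside `Z`, whose membership is not
-- assumed decidable.
avoids⇒cover : ∀ k {Z} r c → DownClosed Z → Avoids Z r c → length r ≤ k → All (_≤ k) c →
  ∃[ L ] ((∀ {p} → Z p → p ∈ L) × length L ≡ 2 * (sum r + sum c))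
avoids⇒cover zero {Z} [] c down av _ c≤0 = [] , (λ {p} Zp → contradiction Zp (empty p)) ,
  cong (2 *_) (sym (sum≡0 c≤0))
  where
  nth≡0 : ∀ {c} → All (_≤ 0) c → ∀ i → nth c i ≡ 0
  nth≡0 [] i = refl
  nth≡0 (z≤n ∷ _) zero = refl
  nth≡0 (_ ∷ c≤0) (suc i) = nth≡0 c≤0 i
  sum≡0 : ∀ {c} → All (_≤ 0) c → sum c ≡ 0
  sum≡0 [] = refl
  sum≡0 (z≤n ∷ c≤0) = sum≡0 c≤0
  empty : ∀ p → ¬ Z p
  -- With `r` empty and `c` zero, the avoided points are all points of the plane.
  empty (u , v) Zp = av u v (down (≤-reflexive (+-identityʳ u))
    (≤-reflexive (trans (cong (v +_) (nth≡0 c≤0 u)) (+-identityʳ v))) Zp)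
avoids⇒cover (suc k) {Z} r c down av |r|≤ c≤
  with avoids⇒cover k {shift₂ Z} (tail r) (map pred c) (λ a≤ b≤ → down a≤ (s≤s (s≤s b≤)))
         (avoids-shift₂ r c down av) (tail≤ r |r|≤) (All.map⁺ (All.map pred-mono-≤ c≤))
  where
  tail≤ : ∀ r → length r ≤ suc k → length (tail r) ≤ k
  tail≤ [] _ = z≤n
  tail≤ (_ ∷ r) (s≤s le) = le
... | L , cover , len = bottom ++ map up L , covered , length-eq
  where
  W : ℕ
  W = nth r 0 + positives c
  bottom : List Point
  bottom = map (_, 0) (upTo W) ++ map (_, 1) (upTo W)
  up : Point → Point
  up (u , v) = u , 2 + v
  covered : ∀ {p} → Z p → p ∈ bottom ++ map up L
  covered {u , zero} Zp = ∈-++⁺ˡ (∈-++⁺ˡ (∈-map⁺ (_, 0) (∈-upTo⁺ (width-bound r c down av Zp))))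
  covered {u , suc zero} Zp =
    ∈-++⁺ˡ (∈-++⁺ʳ (map (_, 0) (upTo W)) (∈-map⁺ (_, 1) (∈-upTo⁺ (width-bound r c down av Zp))))
  covered {u , suc (suc v)} Zp = ∈-++⁺ʳ bottom (∈-map⁺ up (cover Zp))
  length-row : ∀ v → length (map (_, v) (upTo W)) ≡ W
  length-row v = trans (length-map (_, v) (upTo W)) (length-upTo W)
  regroup : ∀ a b d e → (a + b + (a + b)) + 2 * (d + e) ≡ 2 * ((a + d) + (b + e))
  regroup = solve-∀
  open ≡-Reasoning
  length-eq : length (bottom ++ map up L) ≡ 2 * (sum r + sum c)
  length-eq = begin
    length (bottom ++ map up L)
      ≡⟨ length-++ bottom ⟩
    length bottom + length (map up L)
      ≡⟨ cong₂ _+_ (length-++ (map (_, 0) (upTo W))) (trans (length-map up L) len) ⟩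
    length (map (_, 0) (upTo W)) + length (map (_, 1) (upTo W)) + 2 * (sum (tail r) + sum (map pred c))
      ≡⟨ cong (_+ 2 * (sum (tail r) + sum (map pred c))) (cong₂ _+_ (length-row 0) (length-row 1)) ⟩
    (W + W) + 2 * (sum (tail r) + sum (map pred c))
      ≡⟨ regroup (nth r 0) (positives c) _ _ ⟩
    2 * ((nth r 0 + sum (tail r)) + (positives c + sum (map pred c)))
      ≡⟨ cong (2 *_) (cong₂ _+_ (sum-tail r) (sum-pred c)) ⟨
    2 * (sum r + sum c) ∎

lower-bound : ∀ {Z} → DownClosed Z → ∀ {n} → AtLeast Z n → ∀ A → Spans Z (ListSet A) → n ≤ 4 * length A
lower-bound {Z} down {n} Z≥n A spans
  with r , sum-r , prof-r ← fibreProfile proj₂ A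
  with c , sum-c , prof-c ← fibreProfile proj₁ A
  with L , cover , len ← avoids⇒cover (length r + max 0 c) r c down
         (spans⇒avoids down r c prof-r prof-c spans) (m≤m+n _ _)
         (All.map (λ x≤ → ≤-trans x≤ (m≤n+m _ (length r))) (xs≤max 0 c)) = begin
  n                            ≤⟨ atLeast-cover L cover Z≥n ⟩
  length L                     ≡⟨ len ⟩
  -- Each point of `A` is counted once in its row and once in its column.
  2 * (sum r + sum c)          ≡⟨ cong (2 *_) (cong₂ _+_ sum-r sum-c) ⟩
  2 * (length A + length A)    ≡⟨ double (length A) ⟩
  4 * length A                 ∎
  where
  open ≤-Reasoning
  double : ∀ a → 2 * (a + a) ≡ 4 * a
  double = solve-∀

-- Upper bound

-- Injectivity is asked only on `S`, because the maps used below overwrite a coordinate that is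
-- constant on `S`.
module _ {S S′ : Subset} (f : Point → Point) (f-map : ∀ {p} → S p → S′ (f p))
         (f-inj : ∀ {p q} → S p → S q → f p ≡ f q → p ≡ q) where

  unique-map : ∀ {xs} → All S xs → Unique xs → Unique (map f xs)
  unique-map [] [] = []
  unique-map (Sx ∷ Sxs) (x∉xs ∷ uxs) =
    All.map⁺ (All.zipWith (λ (Sy , x≢y) fx≡fy → x≢y (f-inj Sx Sy fx≡fy)) (Sxs , x∉xs)) ∷
    unique-map Sxs uxs

  atLeast-map : ∀ {n} → AtLeast S n → AtLeast S′ n
  atLeast-map (xs , uxs , ≡n , Sxs) =
    map f xs , unique-map Sxs uxs , trans (length-map f xs) ≡n , All.map⁺ (All.map f-map Sxs)

  hasCard-map : (∀ {q} → S′ q → ∃[ p ] (S p × q ≡ f p)) → ∀ {n} → HasCard S n → HasCard S′ n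
  hasCard-map f-surj (xs , uxs , ≡n , S⇔xs) =
    map f xs , unique-map (All.tabulate (from (S⇔xs _))) uxs , trans (length-map f xs) ≡n ,
    λ q → mk⇔ (onto q) (into q)
    where
    onto : ∀ q → S′ q → q ∈ map f xs
    onto q S′q with f-surj S′q
    ... | p , Sp , refl = ∈-map⁺ f (to (S⇔xs p) Sp)
    into : ∀ q → q ∈ map f xs → S′ q
    into q q∈ with ∈-map⁻ f q∈
    ... | p , p∈xs , refl = f-map (from (S⇔xs p) p∈xs)

-- Deciding the counts along lines

Sized : Subset → Set
Sized S = Infinite S ⊎ ∃[ n ] HasCard S n

module _ (e : ℕ → Point) (e-inj : ∀ {k l} → e k ≡ e l → k ≡ l) {S : Subset} where

  line-atLeast : ∀ n → (∀ {k} → k < n → S (e k)) → AtLeast S n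
  line-atLeast n S[e] =
    applyUpTo e n , Unique.applyUpTo⁺₁ e n (λ i<j _ eq → <⇒≢ i<j (e-inj eq)) ,
    length-applyUpTo e n , All.applyUpTo⁺₁ e n S[e]

  line-hasCard : ∀ N → (∀ k → Dec (S (e k))) → (∀ p → S p → ∃[ k ] (k < N × p ≡ e k)) →
    ∃[ n ] HasCard S n
  line-hasCard N S? S⊆e = _ , xs , Unique.map⁺ e-inj (Unique.filter⁺ S? (Unique.upTo⁺ N)) , refl ,
    λ p → mk⇔ (S⇒xs p) (xs⇒S p)
    where
    xs : List Point
    xs = map e (filter S? (upTo N))
    S⇒xs : ∀ p → S p → p ∈ xs
    S⇒xs p Sp with S⊆e p Sp
    ... | k , k<N , refl = ∈-map⁺ e (∈-filter⁺ S? (∈-upTo⁺ k<N) Sp)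
    xs⇒S : ∀ p → p ∈ xs → S p
    xs⇒S p p∈xs with ∈-map⁻ e p∈xs
    ... | k , k∈ , refl = proj₂ (∈-filter⁻ S? {xs = upTo N} k∈)

-- Membership is constant from index `N` on, so its value at `N` decides: either the whole tail lies
-- in `S`, or `S` is confined to the first `N` indices.
line-sized : (e : ℕ → Point) → (∀ {k l} → e k ≡ e l → k ≡ l) → ∀ {S : Subset} N →
  (∀ k → Dec (S (e k))) → (∀ {k l} → N ≤ k → N ≤ l → S (e k) → S (e l)) →
  (∀ p → S p → ∃[ k ] p ≡ e k) → Sized S
line-sized e e-inj {S} N S? const S⊆e with S? N
... | yes SeN = inj₁ λ n →
  line-atLeast (λ k → e (N + k)) (+-cancelˡ-≡ N _ _ ∘ e-inj) n (λ _ → const ≤-refl (m≤m+n N _) SeN)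
... | no ¬SeN = inj₂ (line-hasCard e e-inj N S? bounded)
  where
  bounded : ∀ p → S p → ∃[ k ] (k < N × p ≡ e k)
  bounded p Sp with S⊆e p Sp
  ... | k , refl = k , ≰⇒> (λ N≤k → ¬SeN (const N≤k ≤-refl Sp)) , refl

-- Finite sets have this property, T preserves it, and it makes every row and
-- column count of an iterate computable.
record Tame (N : ℕ) (S : Subset) : Set where
  field
    dec : Decidable S
    row-const : ∀ {p q y} → N ≤ p → N ≤ q → S (p , y) → S (q , y)
    col-const : ∀ {x p q} → N ≤ p → N ≤ q → S (x , p) → S (x , q)

module _ {N S} (tame : Tame N S) where
  open Tame tame

  row-sized : ∀ p → Sized (RowSet S p)
  row-sized (_ , y) = line-sized (_, y) (cong proj₁) N dec-row
    (λ N≤k N≤l (Sk , eq) → row-const N≤k N≤l Sk , eq) (λ { (k , _) (_ , refl) → k , refl })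
    where
    dec-row : ∀ k → Dec (S (k , y) × y ≡ y)
    dec-row k with dec (k , y)
    ... | yes s = yes (s , refl)
    ... | no ¬s = no (¬s ∘ proj₁)

  col-sized : ∀ p → Sized (ColSet S p)
  col-sized (x , _) = line-sized (x ,_) (cong proj₂) N dec-col
    (λ N≤k N≤l (Sk , eq) → col-const N≤k N≤l Sk , eq) (λ { (_ , k) (_ , refl) → k , refl })
    where
    dec-col : ∀ k → Dec (S (x , k) × x ≡ x)
    dec-col k with dec (x , k)
    ... | yes s = yes (s , refl)
    ... | no ¬s = no (¬s ∘ proj₁)

  module _ {Z : Subset} (Z? : Decidable Z) where

    -- The second alternative is the failure of `CountsOutside` in positive form, with explicit
    -- finite counts.
    countsOutside-cases : ∀ p → CountsOutside Z S p ⊎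
      ∃[ r ] ∃[ c ] (HasCard (RowSet S p) r × HasCard (ColSet S p) c × Z (r , c))
    countsOutside-cases p with row-sized p | col-sized p
    ... | inj₁ row∞ | _ = inj₁ (inj₂ (inj₁ row∞))
    ... | inj₂ _ | inj₁ col∞ = inj₁ (inj₂ (inj₂ col∞))
    ... | inj₂ (r , row) | inj₂ (c , col) with Z? (r , c)
    ...   | yes Zrc = inj₂ (r , c , row , col , Zrc)
    ...   | no ¬Zrc = inj₁ (inj₁ (r , c , row , col , ¬Zrc))

    T-dec : Decidable (T Z S)
    T-dec p with dec p | countsOutside-cases p
    ... | yes Sp | _ = yes (inj₁ Sp)
    ... | no _ | inj₁ out = yes (inj₂ out)
    ... | no ¬Sp | inj₂ (r , c , row , col , Zrc) = no λ where
      (inj₁ Sp) → ¬Sp Sp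
      (inj₂ (inj₁ (r′ , c′ , row′ , col′ , ¬Z))) →
        ¬Z (subst₂ (λ a b → Z (a , b)) (hasCard-unique row row′) (hasCard-unique col col′) Zrc)
      (inj₂ (inj₂ (inj₁ row∞))) → infinite⇒¬hasCard row∞ row
      (inj₂ (inj₂ (inj₂ col∞))) → infinite⇒¬hasCard col∞ col

    -- The two points share their row, and beyond `N` their columns have the same heights in `S`, so
    -- `f` carries the column count across. Hence `N` need not grow under `T`.
    T-row-const : ∀ {p q y} → N ≤ p → N ≤ q → T Z S (p , y) → T Z S (q , y)
    T-row-const {p} {q} {y} N≤p N≤q = λ where
        (inj₁ Sp) → inj₁ (row-const N≤p N≤q Sp)
        (inj₂ (inj₁ (r , c , row , col , ¬Z))) →
          inj₂ (inj₁ (r , c , row , hasCard-map f f-map f-inj f-surj col , ¬Z))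
        (inj₂ (inj₂ (inj₁ row∞))) → inj₂ (inj₂ (inj₁ row∞))
        (inj₂ (inj₂ (inj₂ col∞))) → inj₂ (inj₂ (inj₂ (atLeast-map f f-map f-inj ∘ col∞)))
      where
      f : Point → Point
      f (_ , k) = q , k
      f-map : ∀ {a} → ColSet S (p , y) a → ColSet S (q , y) (f a)
      f-map (Sa , refl) = row-const N≤p N≤q Sa , refl
      f-inj : ∀ {a b} → ColSet S (p , y) a → ColSet S (p , y) b → f a ≡ f b → a ≡ b
      f-inj (_ , refl) (_ , refl) refl = refl
      f-surj : ∀ {b} → ColSet S (q , y) b → ∃[ a ] (ColSet S (p , y) a × b ≡ f a)
      f-surj {_ , k} (Sb , refl) = (p , k) , (row-const N≤q N≤p Sb , refl) , refl

    T-col-const : ∀ {x p q} → N ≤ p → N ≤ q → T Z S (x , p) → T Z S (x , q)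
    T-col-const {x} {p} {q} N≤p N≤q = λ where
        (inj₁ Sp) → inj₁ (col-const N≤p N≤q Sp)
        (inj₂ (inj₁ (r , c , row , col , ¬Z))) →
          inj₂ (inj₁ (r , c , hasCard-map f f-map f-inj f-surj row , col , ¬Z))
        (inj₂ (inj₂ (inj₁ row∞))) → inj₂ (inj₂ (inj₁ (atLeast-map f f-map f-inj ∘ row∞)))
        (inj₂ (inj₂ (inj₂ col∞))) → inj₂ (inj₂ (inj₂ col∞))
      where
      f : Point → Point
      f (k , _) = k , q
      f-map : ∀ {a} → RowSet S (x , p) a → RowSet S (x , q) (f a)
      f-map (Sa , refl) = col-const N≤p N≤q Sa , refl
      f-inj : ∀ {a b} → RowSet S (x , p) a → RowSet S (x , p) b → f a ≡ f b → a ≡ b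
      f-inj (_ , refl) (_ , refl) refl = refl
      f-surj : ∀ {b} → RowSet S (x , q) b → ∃[ a ] (RowSet S (x , p) a × b ≡ f a)
      f-surj {k , _} (Sb , refl) = (k , p) , (col-const N≤q N≤p Sb , refl) , refl

    T-tame : Tame N (T Z S)
    T-tame = record { dec = T-dec ; row-const = T-row-const ; col-const = T-col-const }

listSet-tame : ∀ xs → ∃[ N ] Tame N (ListSet xs)
listSet-tame xs = N , record
  { dec = _∈ᵖ? xs
  ; row-const = λ N≤p _ ∈xs → contradiction (≤-trans (bound proj₁ ∈xs) (m≤m+n _ _)) (<⇒≱ N≤p)
  ; col-const = λ N≤p _ ∈xs → contradiction (≤-trans (bound proj₂ ∈xs) (m≤n+m _ _)) (<⇒≱ N≤p)
  }
  where
  N : ℕ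
  -- `N` exceeds every coordinate occurring in `xs`, so both constancy conditions are vacuous.
  N = suc (max 0 (map proj₁ xs) + max 0 (map proj₂ xs))
  bound : (f : Point → ℕ) → ∀ {p} → p ∈ xs → f p ≤ max 0 (map f xs)
  bound f p∈xs = All.lookup (xs≤max 0 (map f xs)) (∈-map⁺ f p∈xs)

iter-tame : ∀ {Z N A} → Decidable Z → Tame N A → ∀ t → Tame N (Iter Z t A)
iter-tame Z? tame zero = tame
iter-tame Z? tame (suc t) = T-tame (iter-tame Z? tame t) Z?

iter-⊇ : ∀ {Z A} t {p} → A p → Iter Z t A p
iter-⊇ zero Ap = Ap
iter-⊇ (suc t) Ap = inj₁ (iter-⊇ t Ap)

-- With rows 0, …, t ∸ 1 full, a point of row t has column count at least t, and
-- its row count r is at least the length of row t of Z, so (r , t) ∉ Z.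
rows-fill : ∀ {Z N A} → DownClosed Z → Decidable Z → Tame N A → (∀ {p} → Z p → A p) →
  ∀ t x {y} → y < t → Iter Z t A (x , y)
rows-fill {Z} {N} {A} down Z? tame Z⊆A (suc t) x {y} (s≤s y≤t) with m≤n⇒m<n∨m≡n y≤t
... | inj₁ y<t = inj₁ (rows-fill down Z? tame Z⊆A t x y<t)
... | inj₂ refl with countsOutside-cases (iter-tame Z? tame t) Z? (x , t)
...   | inj₁ out = inj₂ out
...   | inj₂ (r , c , row , col , Zrc) = contradiction (atLeast≤hasCard row≥1+r row) 1+n≰n
  where
  col≥t : AtLeast (ColSet (Iter Z t A) (x , t)) t
  col≥t = line-atLeast (x ,_) (cong proj₂) t (λ k<t → rows-fill down Z? tame Z⊆A t x k<t , refl)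
  -- Since `t ≤ c` and `(r , c)` is in `Z`, the points `(0 , t)` up to `(r , t)` all lie in `Z`: one
  -- more than the row count `r` allows.
  row≥1+r : AtLeast (RowSet (Iter Z t A) (x , t)) (suc r)
  row≥1+r = line-atLeast (_, t) (cong proj₁) (suc r)
    (λ { (s≤s k≤r) → iter-⊇ t (Z⊆A (down k≤r (atLeast≤hasCard col≥t col) Zrc)) , refl })

upper-bound : ∀ {Z} → DownClosed Z → ∀ {n} → HasCard Z n → ∃[ A ] (FinSpans Z A × length A ≤ n)
upper-bound {Z} down (zs , uzs , refl , Z⇔zs) =
  zs , (uzs , λ (x , y) → suc y , rows-fill down Z? tame (to (Z⇔zs _)) (suc y) x ≤-refl) , ≤-refl
  where
  tame = proj₂ (listSet-tame zs)
  Z? : Decidable Z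
  Z? p with p ∈ᵖ? zs
  ... | yes p∈ = yes (from (Z⇔zs p) p∈)
  ... | no p∉ = no (p∉ ∘ to (Z⇔zs p))

theorem1p1 : (Z : Subset) → IsZeroSet Z →
    ((n : ℕ) → AtLeast Z n → (A : List Point) → FinSpans Z A → n ≤ 4 * length A)
    × ((n : ℕ) → HasCard Z n → ∃[ A ] (FinSpans Z A × length A ≤ n))
theorem1p1 Z zs =
  (λ n Z≥n A (_ , spans) → lower-bound (zeroSet⇒downClosed zs) Z≥n A spans) ,
  (λ n → upper-bound (zeroSet⇒downClosed zs))
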